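{- Every $2$-connected $\{K_{1,3}^{**},K_3\}$-free graph has a longest cycle which is a dominating cycle of the graph.
   Context: All graphs are finite and simple. A cycle $C$ in a graph $G$ is dominating if every edge of $G$ has at least one end vertex on $C$. $G$ is $\{K_{1,3}^{**},K_3\}$-free if it contains neither $K_{1,3}^{**}$ nor a triangle $K_3$ as an induced subgraph. $K_{1,3}^{*}$ is the graph obtained from the claw $K_{1,3}$ by subdividing each edge once, and $K_{1,3}^{**}$ is obtained from $K_{1,3}^{*}$ by deleting one vertex of degree $1$. -}

module Defs where

open import Data.Nat using (ℕ; zero; suc; _≤_; _<_)
open import Data.Fin using (Fin; zero; suc)
open import Data.Bool using (Bool; true; false; _∨_)
open import Data.Bool.Properties using (∨-comm)
open import Data.Unit using (⊤)
import Data.List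
open import Data.List using (List; []; _∷_; length; last)
open import Data.List.Membership.Propositional using (_∈_)
open import Data.List.Relation.Unary.Unique.Propositional using (Unique)
open import Data.Maybe using (just)
open import Data.Product using (Σ; _×_; ∃; ∃-syntax)
open import Data.Sum using (_⊎_)
open import Relation.Binary.PropositionalEquality using (_≡_; _≢_; refl)
open import Relation.Nullary using (¬_)
open import Function.Definitions using (Injective)

record Graph (n : ℕ) : Set where
  field
    adj    : Fin n → Fin n → Bool
    sym    : ∀ u v → adj u v ≡ adj v u
    irrefl : ∀ v → adj v v ≡ false
open Graph public

Edge : ∀ {n} → Graph n → Fin n → Fin n → Set
Edge G u v = adj G u v ≡ true

data WalkIn {n} (G : Graph n) (P : Fin n → Set) : Fin n → Fin n → Set where
  here : ∀ {u} → P u → WalkIn G P u u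
  step : ∀ {u w v} → P u → Edge G u w → WalkIn G P w v → WalkIn G P u v

ConnectedOn : ∀ {n} → Graph n → (Fin n → Set) → Set
ConnectedOn G P = ∀ u v → P u → P v → WalkIn G P u v

TwoConnected : ∀ {n} → Graph n → Set
TwoConnected {n} G =
  (3 ≤ n) × ConnectedOn G (λ _ → ⊤) × (∀ (x : Fin n) → ConnectedOn G (λ y → y ≢ x))

data Path {n} (G : Graph n) : List (Fin n) → Set where
  nil   : Path G []
  one   : ∀ {v} → Path G (v ∷ [])
  cons  : ∀ {u v vs} → Edge G u v → Path G (v ∷ vs) → Path G (u ∷ v ∷ vs)

record Cycle {n} (G : Graph n) : Set where
  constructor mkCycle
  field
    verts    : List (Fin n)
    distinct : Unique verts
    long     : 3 ≤ length verts
    path     : Path G verts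
    closing  : ∃[ f ] ∃[ l ] (Data.List.head verts ≡ just f) × (last verts ≡ just l) × Edge G l f
open Cycle public

cycleLength : ∀ {n} {G : Graph n} → Cycle G → ℕ
cycleLength C = length (verts C)

OnCycle : ∀ {n} {G : Graph n} → Fin n → Cycle G → Set
OnCycle v C = v ∈ verts C

LongestCycle : ∀ {n} (G : Graph n) → Cycle G → Set
LongestCycle G C = ∀ (D : Cycle G) → cycleLength D ≤ cycleLength C

Dominating : ∀ {n} (G : Graph n) → Cycle G → Set
Dominating G C = ∀ u v → Edge G u v → OnCycle u C ⊎ OnCycle v C

InducedSub : ∀ {h n} → Graph h → Graph n → Set
InducedSub {h} {n} H G =
  Σ (Fin h → Fin n) λ f → Injective _≡_ _≡_ f × (∀ i j → adj G (f i) (f j) ≡ adj H i j)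

Free : ∀ {h n} → Graph h → Graph n → Set
Free H G = ¬ InducedSub H G

K3 : Graph 3
K3 = record { adj = a ; sym = s ; irrefl = r }
  where
  a : Fin 3 → Fin 3 → Bool
  a zero zero = false
  a (suc zero) (suc zero) = false
  a (suc (suc zero)) (suc (suc zero)) = false
  a _ _ = true
  s : ∀ u v → a u v ≡ a v u
  s zero zero = refl
  s zero (suc zero) = refl
  s zero (suc (suc zero)) = refl
  s (suc zero) zero = refl
  s (suc zero) (suc zero) = refl
  s (suc zero) (suc (suc zero)) = refl
  s (suc (suc zero)) zero = refl
  s (suc (suc zero)) (suc zero) = refl
  s (suc (suc zero)) (suc (suc zero)) = refl
  r : ∀ v → a v v ≡ false
  r zero = refl
  r (suc zero) = refl
  r (suc (suc zero)) = refl

-- K₁,₃** : centre 0 adjacent to 1,2,3; edges 1–4 and 2–5 (the claw with two of its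
-- three edges subdivided once; i.e. K₁,₃* minus one vertex of degree 1).
K13ss : Graph 6
K13ss = record { adj = a ; sym = s ; irrefl = r }
  where
  e : Fin 6 → Fin 6 → Bool
  e zero (suc zero) = true
  e zero (suc (suc zero)) = true
  e zero (suc (suc (suc zero))) = true
  e (suc zero) (suc (suc (suc (suc zero)))) = true
  e (suc (suc zero)) (suc (suc (suc (suc (suc zero))))) = true
  e _ _ = false
  a : Fin 6 → Fin 6 → Bool
  a u v = e u v ∨ e v u
  s : ∀ u v → a u v ≡ a v u
  s u v = ∨-comm (e u v) (e v u)
  r : ∀ v → a v v ≡ false
  r zero = refl
  r (suc zero) = refl
  r (suc (suc zero)) = refl
  r (suc (suc (suc zero))) = refl
  r (suc (suc (suc (suc zero)))) = refl
  r (suc (suc (suc (suc (suc zero))))) = refl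

{-# OPTIONS --safe #-}
module Submission where

-- Let C be a longest cycle and let P = p₁ p₂ … pₖ (k ≥ 2) be a path off C whose ends have
-- distinct neighbours on C; such a P exists if some edge misses C, because G is 2-connected.
-- Take P to be an edge if possible; otherwise p₂ has no neighbour on C.  In both cases every
-- neighbour of p₂ on C is a neighbour of pₖ.
-- Cut C cyclically into segments X, J, Y, U, where X begins and ends with neighbours of p₁,
-- Y begins and ends with neighbours of pₖ, and J and U avoid the neighbours of p₁ and p₂.
-- Suppose J and U can be merged into one path that starts next to an end of X, finishes next
-- to an end of Y and misses at most one vertex.  Closing it up through X, P and Y gives a
-- cycle longer than C, as P has at least two vertices.
-- For the merging, call u and v the ends of U and J next to X.  The spider centred at p₁ shows
-- that u and v are adjacent or have a common neighbour among the ends of X.  In the latter case, seen from that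
-- neighbour, U and J run through breadth-first layers of which consecutive ones are completely
-- joined, so one can zigzag between U and J two layers at a time; in the former case U and J
-- lie in a complete bipartite graph.

open import Data.Bool using (true; false)
import Data.Bool.Properties as Bool
open import Data.Empty using (⊥; ⊥-elim)
open import Data.Fin using (Fin; zero; suc)
open import Data.Fin.Patterns
import Data.Fin.Properties as Fin
open import Data.List using (List; []; _∷_; [_]; _++_; length; reverse; head; last; lookup)
import Data.List.Membership.DecPropositional as DecMembership
open import Data.List.Membership.Propositional using (_∈_; _∉_)
open import Data.List.Membership.Propositional.Properties
  using (∈-∃++; ∈-++⁻; ∈-++⁺ˡ; ∈-++⁺ʳ; ∈-lookup)
open import Data.List.Properties using (++-assoc; ++-identityʳ; unfold-reverse; length-++)
open import Data.List.Relation.Binary.Permutation.Propositional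
open import Data.List.Relation.Binary.Permutation.Propositional.Properties
  using (shifts; ++⁺ˡ; ++⁺ʳ; ++⁺; ++-comm; ↭-length; ↭-reverse; All-resp-↭; ∈-resp-↭)
import Data.List.Relation.Binary.Permutation.Setoid.Properties as Setoid
open import Data.List.Relation.Unary.All as All using (All; []; _∷_)
open import Data.List.Relation.Unary.All.Properties as All using (¬Any⇒All¬)
open import Data.List.Relation.Unary.Any as Any using (Any; here; there)
import Data.List.Relation.Unary.Any.Properties as Any
import Data.List.Relation.Unary.Unique.DecPropositional as DecUnique
open import Data.List.Relation.Unary.Unique.Propositional using (Unique; []; _∷_)
import Data.List.Relation.Unary.Unique.Propositional.Properties as Unique
open import Data.Maybe using (just)
open import Data.Nat using (ℕ; zero; suc; _≤_; _<_; _+_; z≤n; s≤s; _≤?_)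
open import Data.Nat.Properties
open import Data.Product using (Σ; _×_; _,_; proj₁; proj₂; ∃; ∃₂)
open import Data.Sum as Sum using (_⊎_; inj₁; inj₂)
open import Data.Unit using (⊤; tt)
open import Data.Vec as Vec using ([]; _∷_)
open import Function using (_∘_)
open import Level using (0ℓ)
open import Relation.Binary.PropositionalEquality as ≡ using (_≡_; _≢_; cong; subst)
open import Relation.Nullary using (¬_; Dec; yes; no)
open import Relation.Nullary.Decidable using (from-yes; map′; _→-dec_; _×-dec_; ¬?)
open import Relation.Unary using (Pred; Decidable)
open import Defs

private variable
  n : ℕ

-- Splitting, permuting and searching lists

split-last : ∀ {A : Set} {P : Pred A 0ℓ} → Decidable P → ∀ {xs} → Any P xs →
  ∃₂ λ as b → ∃ λ bs → xs ≡ as ++ b ∷ bs × P b × All (¬_ ∘ P) bs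
split-last P? {x ∷ xs} p with Any.any? P? xs
split-last P? {x ∷ xs} p | yes q with split-last P? q
... | as , b , bs , ≡.refl , pb , ¬bs = x ∷ as , b , bs , ≡.refl , pb , ¬bs
split-last P? {x ∷ xs} (here px) | no ¬q = [] , x , xs , ≡.refl , px , ¬Any⇒All¬ xs ¬q
split-last P? {x ∷ xs} (there q) | no ¬q = ⊥-elim (¬q q)

split-first : ∀ {A : Set} {P : Pred A 0ℓ} → Decidable P → ∀ {xs} → Any P xs →
  ∃₂ λ as b → ∃ λ bs → xs ≡ as ++ b ∷ bs × P b × All (¬_ ∘ P) as
split-first P? {x ∷ xs} p with P? x
split-first P? {x ∷ xs} p | yes px = [] , x , xs , ≡.refl , px , []
split-first P? {x ∷ xs} (here px) | no ¬px = ⊥-elim (¬px px)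
split-first P? {x ∷ xs} (there q) | no ¬px with split-first P? q
... | as , b , bs , ≡.refl , pb , ¬as = x ∷ as , b , bs , ≡.refl , pb , ¬px ∷ ¬as

++-interleave : ∀ {A : Set} (as bs : List A) {rs ds us vs} → rs ++ ds ↭ us ++ vs →
  (as ++ (bs ++ rs)) ++ ds ↭ (as ++ us) ++ (bs ++ vs)
++-interleave as bs {rs} {ds} {us} {vs} p = begin
  (as ++ (bs ++ rs)) ++ ds   ≡⟨ ++-assoc as (bs ++ rs) ds ⟩
  as ++ ((bs ++ rs) ++ ds)   ≡⟨ cong (as ++_) (++-assoc bs rs ds) ⟩
  as ++ (bs ++ (rs ++ ds))   ↭⟨ ++⁺ˡ as (++⁺ˡ bs p) ⟩
  as ++ (bs ++ (us ++ vs))   ↭⟨ ++⁺ˡ as (shifts bs us) ⟩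
  as ++ (us ++ (bs ++ vs))   ≡⟨ ++-assoc as us (bs ++ vs) ⟨
  (as ++ us) ++ (bs ++ vs)   ∎
  where open PermutationReasoning

suffix-< : ∀ {A : Set} (as : List A) {b bs} → length bs < length (as ++ b ∷ bs)
suffix-< [] = ≤-refl
suffix-< (_ ∷ as) = m<n⇒m<1+n (suffix-< as)

shorter : ∀ {A : Set} (as : List A) {b c bs xs} → xs ≡ as ++ b ∷ c ∷ bs → length bs < length xs
shorter as ≡.refl = ≤-<-trans (n≤1+n _) (suffix-< as)

unique-resp-↭ : ∀ {xs ys : List (Fin n)} → xs ↭ ys → Unique xs → Unique ys
unique-resp-↭ p = Setoid.Unique-resp-↭ (≡.setoid _) (↭⇒↭ₛ p)

unique-++⁻ˡ : ∀ (xs : List (Fin n)) {ys} → Unique (xs ++ ys) → Unique xs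
unique-++⁻ˡ [] _ = []
unique-++⁻ˡ (x ∷ xs) (px ∷ ps) = All.++⁻ˡ xs px ∷ unique-++⁻ˡ xs ps

unique-++⁻ʳ : ∀ (xs : List (Fin n)) {ys} → Unique (xs ++ ys) → Unique ys
unique-++⁻ʳ [] p = p
unique-++⁻ʳ (_ ∷ xs) (_ ∷ ps) = unique-++⁻ʳ xs ps

lookup-injective : ∀ {xs : List (Fin n)} → Unique xs → ∀ i j → lookup xs i ≡ lookup xs j → i ≡ j
lookup-injective (_ ∷ _) zero zero _ = ≡.refl
lookup-injective (px ∷ _) zero (suc j) eq = ⊥-elim (All.lookup px (∈-lookup j) eq)
lookup-injective (px ∷ _) (suc i) zero eq = ⊥-elim (All.lookup px (∈-lookup i) (≡.sym eq))
lookup-injective (_ ∷ ps) (suc i) (suc j) eq = cong suc (lookup-injective ps i j eq)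

unique⇒length≤ : ∀ {xs : List (Fin n)} → Unique xs → length xs ≤ n
unique⇒length≤ u = Fin.injective⇒≤ λ {i} {j} → lookup-injective u i j

listOfLength? : ∀ k {P : Pred (List (Fin n)) 0ℓ} → Decidable P →
  Dec (∃ λ xs → length xs ≡ k × P xs)
listOfLength? zero P? = map′ (λ p → [] , ≡.refl , p) (λ { ([] , _ , p) → p }) (P? [])
listOfLength? (suc k) P? =
  map′ (λ (x , xs , eq , p) → x ∷ xs , cong suc eq , p)
       (λ { (x ∷ xs , eq , p) → x , xs , suc-injective eq , p })
       (Fin.any? λ x → listOfLength? k (P? ∘ (x ∷_)))

-- Descends from the upper bound `m`, which drops by one each time `P` fails there.
greatest : ∀ {P : Pred ℕ 0ℓ} → Decidable P → ∀ m → (∀ k → P k → k ≤ m) → ∃ P →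
  ∃ λ k → P k × (∀ j → P j → j ≤ k)
greatest P? m bound p with P? m
... | yes pm = m , pm , bound
greatest P? zero bound (k , pk) | no ¬p0 with bound k pk
... | z≤n = ⊥-elim (¬p0 pk)
greatest {P} P? (suc m) bound p | no ¬pm =
  greatest P? m (λ k pk → ≤-pred (≤∧≢⇒< (bound k pk) (λ eq → ¬pm (subst P eq pk)))) p

-- Distinct vertices have distinct neighbourhoods, which makes every map that preserves and
-- reflects adjacency injective.
Separating : ∀ {h} → Graph h → Set
Separating H = ∀ i j → (∀ k → adj H i k ≡ adj H j k) → i ≡ j

separating? : ∀ {h} (H : Graph h) → Dec (Separating H)
separating? H = Fin.all? λ i → Fin.all? λ j →
  Fin.all? (λ k → adj H i k Bool.≟ adj H j k) →-dec (i Fin.≟ j)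

inducedSub : ∀ {h} {H : Graph h} {G : Graph n} → Separating H → (f : Fin h → Fin n) →
  (∀ i j → adj G (f i) (f j) ≡ adj H i j) → InducedSub H G
inducedSub {H = H} {G} sep f e = f , (λ {i} {j} → inj i j) , e
  where
  inj : ∀ i j → f i ≡ f j → i ≡ j
  inj i j fi≡fj = sep i j λ k →
    ≡.trans (≡.sym (e i k)) (≡.trans (cong (λ v → adj G v (f k)) fi≡fj) (e j k))

-- Adjacency and trails

module _ (G : Graph n) where

  private
    _~_ : Fin n → Fin n → Set
    _~_ = Edge G

    _≁_ : Fin n → Fin n → Set
    u ≁ v = ¬ Edge G u v

  edge? : ∀ u v → Dec (Edge G u v)
  edge? u v = adj G u v Bool.≟ true

  edge-sym : ∀ {u v} → Edge G u v → Edge G v u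
  edge-sym {u} {v} e = ≡.trans (Graph.sym G v u) e

  non-edge : ∀ {u v} → ¬ Edge G u v → adj G u v ≡ false
  non-edge = Bool.¬-not

  edge⇒≢ : ∀ {u v} → Edge G u v → u ≢ v
  edge⇒≢ {u} e ≡.refl = Bool.not-¬ (irrefl G u) e

  triangle-free : Free K3 G → ∀ {a b c} → Edge G a b → Edge G b c → ¬ Edge G a c
  triangle-free free {a} {b} {c} ab bc ac =
    free (inducedSub {H = K3} {G} (from-yes (separating? K3)) (Vec.lookup (a ∷ b ∷ c ∷ [])) table)
    where
    table : ∀ i j → _
    table 0F 0F = irrefl G a
    table 0F 1F = ab
    table 0F 2F = ac
    table 1F 0F = edge-sym ab
    table 1F 1F = irrefl G b
    table 1F 2F = bc
    table 2F 0F = edge-sym ac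
    table 2F 1F = edge-sym bc
    table 2F 2F = irrefl G c

  infixr 5 _∷_

  -- Both ends are indices, so joining and reversing need no side conditions. Vertices may repeat;
  -- distinctness is kept apart as `Unique` and carried along permutations.
  data Trail : Fin n → List (Fin n) → Fin n → Set where
    end : ∀ {v} → Trail v (v ∷ []) v
    _∷_ : ∀ {u v vs w} → Edge G u v → Trail v vs w → Trail u (u ∷ vs) w

  join : ∀ {a xs b c ys d} → Trail a xs b → Edge G b c → Trail c ys d → Trail a (xs ++ ys) d
  join end e t = e ∷ t
  join (e′ ∷ s) e t = e′ ∷ join s e t

  reverse-trail : ∀ {a xs b} → Trail a xs b → Trail b (reverse xs) a
  reverse-trail end = end
  reverse-trail (_∷_ {u} {v} {vs} e t) =
    subst (λ l → Trail _ l _) (≡.sym (unfold-reverse u vs)) (join (reverse-trail t) (edge-sym e) end)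

  cut : ∀ {a b} x xs {y ys} → Trail a (x ∷ xs ++ y ∷ ys) b →
    ∃ λ q → Trail a (x ∷ xs) q × Edge G q y × Trail y (y ∷ ys) b
  cut x [] (e ∷ t@end) = x , end , e , t
  cut x [] (e ∷ t@(_ ∷ _)) = x , end , e , t
  cut x (x′ ∷ xs) (e ∷ t) with cut x′ xs t
  ... | q , s , qy , t′ = q , e ∷ s , qy , t′

  first∈ : ∀ {a xs b} → Trail a xs b → a ∈ xs
  first∈ end = here ≡.refl
  first∈ (_ ∷ _) = here ≡.refl

  last∈ : ∀ {a xs b} → Trail a xs b → b ∈ xs
  last∈ end = here ≡.refl
  last∈ (_ ∷ t) = there (last∈ t)

  trail-length : ∀ {a xs b} → Trail a xs b → 1 ≤ length xs
  trail-length end = s≤s z≤n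
  trail-length (_ ∷ _) = s≤s z≤n

  uncons : ∀ {u v vs w} → Trail u (u ∷ v ∷ vs) w → u ~ v × Trail v (v ∷ vs) w
  uncons t with cut _ [] t
  ... | _ , end , e , t′ = e , t′

  trail-head : ∀ {a x xs b} → Trail a (x ∷ xs) b → a ≡ x
  trail-head end = ≡.refl
  trail-head (_ ∷ _) = ≡.refl

  trail-∷ : ∀ {a xs b} → Trail a xs b → ∃ λ xs′ → xs ≡ a ∷ xs′
  trail-∷ end = _ , ≡.refl
  trail-∷ (_ ∷ _) = _ , ≡.refl

  prefix : ∀ {a x xs b} ys → Trail a (x ∷ xs ++ ys) b → ∃ λ q → Trail a (x ∷ xs) q
  prefix {a} {x} {xs} {b} [] t = b , subst (λ l → Trail a l b) (++-identityʳ (x ∷ xs)) t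
  prefix {x = x} {xs} (_ ∷ _) t with cut x xs t
  ... | q , s , _ = q , s

  suffix : ∀ {a b y ys} xs → Trail a (xs ++ y ∷ ys) b → Trail y (y ∷ ys) b
  suffix [] t with trail-head t
  ... | ≡.refl = t
  suffix (x ∷ xs) t with cut x xs t
  ... | _ , _ , _ , t′ = t′

  -- A trail along `zs` determines the first and last entries of `zs`, so quantifying over trails
  -- speaks of these entries without extracting them from the list.
  Ends : Pred (Fin n) 0ℓ → List (Fin n) → Set
  Ends P zs = ∀ {a b} → Trail a zs b → P a × P b

  span : ∀ {P : Pred (Fin n) 0ℓ} → Decidable P → ∀ {xs} → Any P xs →
    ∃₂ λ as y → ∃₂ λ ys bs → xs ≡ as ++ (y ∷ ys) ++ bs ×
      All (¬_ ∘ P) as × All (¬_ ∘ P) bs × Ends P (y ∷ ys)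
  span {P} P? p with split-first P? p
  ... | as , b , r , ≡.refl , pb , ¬as with split-last P? {b ∷ r} (here pb)
  ...   | [] , c , ds , ≡.refl , pc , ¬ds =
    as , b , [] , ds , ≡.refl , ¬as , ¬ds , λ { end → pc , pc }
  ...   | _ ∷ cs , c , ds , ≡.refl , pc , ¬ds =
    as , b , cs ++ [ c ] , ds , cong (λ l → as ++ b ∷ l) (≡.sym (++-assoc cs [ c ] ds)) ,
    ¬as , ¬ds , ends
    where
    ends : Ends P (b ∷ cs ++ [ c ])
    ends t with trail-head t | suffix (b ∷ cs) t
    ... | ≡.refl | end = pb , pc

  -- Closed trails and longest cycles

  Closed : List (Fin n) → Set
  Closed zs = ∃₂ λ a b → Trail a zs b × b ~ a

  rotate : ∀ as bs → Closed (as ++ bs) → Closed (bs ++ as)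
  rotate [] bs c = subst Closed (≡.sym (++-identityʳ bs)) c
  rotate (a ∷ as) [] c = subst Closed (cong (a ∷_) (++-identityʳ as)) c
  rotate (a ∷ as) (b ∷ bs) (_ , _ , t , e) with cut a as t
  ... | _ , s , qb , t′ = _ , _ , join t′ e s , qb

  trail⇒path : ∀ {a xs b} → Trail a xs b → Path G xs
  trail⇒path end = one
  trail⇒path (e ∷ end) = cons e one
  trail⇒path (e ∷ t@(_ ∷ _)) = cons e (trail⇒path t)

  trail-first : ∀ {a xs b} → Trail a xs b → head xs ≡ just a
  trail-first end = ≡.refl
  trail-first (_ ∷ _) = ≡.refl

  trail-last : ∀ {a xs b} → Trail a xs b → last xs ≡ just b
  trail-last end = ≡.refl
  trail-last (_ ∷ end) = ≡.refl
  trail-last (_ ∷ t@(_ ∷ _)) = trail-last t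

  path⇒trail : ∀ {x xs b} → Path G (x ∷ xs) → last (x ∷ xs) ≡ just b → Trail x (x ∷ xs) b
  path⇒trail one ≡.refl = end
  path⇒trail (cons e p) eq = e ∷ path⇒trail p eq

  closed⇒cycle : ∀ {zs} → Unique zs → 3 ≤ length zs → Closed zs → Cycle G
  closed⇒cycle {zs} u l (a , b , t , e) =
    mkCycle zs u l (trail⇒path t) (a , b , trail-first t , trail-last t , e)

  cycle-closed : (C : Cycle G) → Closed (verts C)
  cycle-closed (mkCycle (_ ∷ _) _ _ p (_ , _ , ≡.refl , eq , e)) = _ , _ , path⇒trail p eq , e

  trail? : ∀ x xs b → Dec (Trail x (x ∷ xs) b)
  trail? x [] b = map′ (λ { ≡.refl → end }) (λ { end → ≡.refl }) (x Fin.≟ b)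
  trail? x (y ∷ ys) b = map′ (λ (e , t) → e ∷ t) uncons (edge? x y ×-dec trail? y ys b)

  closed? : Decidable Closed
  closed? [] = no λ ()
  closed? (x ∷ xs) = map′ (λ (b , c) → x , b , c) from (Fin.any? λ b → trail? x xs b ×-dec edge? b x)
    where
    from : Closed (x ∷ xs) → ∃ λ b → Trail x (x ∷ xs) b × b ~ x
    from (_ , b , t , e) with trail-head t
    ... | ≡.refl = b , t , e

  longest : Cycle G → Σ (Cycle G) (LongestCycle G)
  longest C₀ =
    let k , (zs , len , u , l , c) , bound =
          greatest {P = λ k → ∃ λ zs → length zs ≡ k × Cyclic zs} (λ k → listOfLength? k cyclic?) n
            (λ { _ (_ , ≡.refl , u , _) → unique⇒length≤ u })
            (_ , verts C₀ , ≡.refl , cyclic C₀)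
    in closed⇒cycle u l c ,
       λ D → ≤-trans (bound _ (verts D , ≡.refl , cyclic D)) (≤-reflexive (≡.sym len))
    where
    Cyclic : Pred (List (Fin n)) 0ℓ
    Cyclic zs = Unique zs × 3 ≤ length zs × Closed zs
    cyclic? : Decidable Cyclic
    cyclic? zs = DecUnique.unique? Fin._≟_ zs ×-dec (3 ≤? length zs) ×-dec closed? zs
    cyclic : ∀ C → Cyclic (verts C)
    cyclic C = distinct C , Cycle.long C , cycle-closed C

  -- Walks and the existence of a cycle

  module _ {P : Fin n → Set} where

    walk-start : ∀ {u v} → WalkIn G P u v → P u
    walk-start (here p) = p
    walk-start (step p _ _) = p

    walk-++ : ∀ {u v w} → WalkIn G P u v → WalkIn G P v w → WalkIn G P u w
    walk-++ (here _) r = r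
    walk-++ (step p e s) r = step p e (walk-++ s r)

    walk-sym : ∀ {u v} → WalkIn G P u v → WalkIn G P v u
    walk-sym (here p) = here p
    walk-sym (step p e s) = walk-++ (walk-sym s) (step (walk-start s) (edge-sym e) (here p))

    first-step : ∀ {u v} → WalkIn G P u v → u ≢ v → ∃ λ w → u ~ w × P w
    first-step (here _) u≢u = ⊥-elim (u≢u ≡.refl)
    first-step (step _ e s) _ = _ , e , walk-start s

    walk⇒trail : ∀ {u v} → WalkIn G P u v → ∃ λ xs → Trail u xs v × Unique xs × All P xs
    walk⇒trail (here p) = _ , end , [] ∷ [] , p ∷ []
    walk⇒trail (step {u} p e s) with walk⇒trail s
    ... | xs , t , uxs , pxs with DecMembership._∈?_ Fin._≟_ u xs
    ...   | no u∉xs = u ∷ xs , e ∷ t , ¬Any⇒All¬ xs u∉xs ∷ uxs , p ∷ pxs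
    -- Loop erasure: the trail is shortened to start at the earlier found occurrence of `u`.
    ...   | yes u∈xs with ∈-∃++ u∈xs
    ...     | as , bs , ≡.refl =
      u ∷ bs , suffix as t , unique-++⁻ʳ as uxs , All.++⁻ʳ as pxs

  trail-length≥2 : ∀ {a xs b} → Trail a xs b → a ≢ b → 2 ≤ length xs
  trail-length≥2 end a≢a = ⊥-elim (a≢a ≡.refl)
  trail-length≥2 (_ ∷ t) _ = s≤s (trail-length t)

  -- Vertex 0 has a neighbour `d₁`; a walk from 0 to 2 avoiding `d₁` gives a second one, `d₂`. A
  -- trail from `d₁` to `d₂` avoiding 0 closes up through 0.
  some-cycle : TwoConnected G → Cycle G
  some-cycle (s≤s (s≤s (s≤s _)) , _ , conn)
    with first-step (conn 2F 0F 1F (λ ()) (λ ())) (λ ())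
  ... | d₁ , ad₁ , d₁≢c
    with first-step (conn d₁ 0F 2F (edge⇒≢ ad₁) (d₁≢c ∘ ≡.sym)) (λ ())
  ... | d₂ , ad₂ , d₂≢d₁
    with walk⇒trail (conn 0F d₁ d₂ (edge⇒≢ ad₁ ∘ ≡.sym) (edge⇒≢ ad₂ ∘ ≡.sym))
  ... | xs , t , uxs , 0∉xs =
    closed⇒cycle (All.map (_∘ ≡.sym) 0∉xs ∷ uxs) (s≤s (trail-length≥2 t (d₂≢d₁ ∘ ≡.sym)))
      (_ , _ , ad₁ ∷ t , edge-sym ad₂)

  -- Merging two trails

  record Merge (us vs : List (Fin n)) (u u′ v v′ : Fin n) : Set where
    field
      {start finish} : Fin n
      {route dropped} : List (Fin n)
      trail   : Trail start route finish
      start∈  : start ≡ u ⊎ start ≡ v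
      finish∈ : finish ≡ u′ ⊎ finish ≡ v′
      -- Losing one vertex is affordable: the path off the cycle contributes at least two.
      few     : length dropped ≤ 1
      perm    : route ++ dropped ↭ us ++ vs
  open Merge public

  swap-merge : ∀ {us vs u u′ v v′} → Merge us vs u u′ v v′ → Merge vs us v v′ u u′
  swap-merge {us} {vs} M = record
    { trail = trail M
    ; start∈ = Sum.swap (start∈ M)
    ; finish∈ = Sum.swap (finish∈ M)
    ; few = few M
    ; perm = ↭-trans (perm M) (++-comm us vs)
    }

  -- Since `q` is adjacent to both possible starts, it does not matter with which trail the merge
  -- begins.
  extend-merge : ∀ {as us vs u u′ v v′ a q} → Trail a as q → q ~ u → q ~ v →
    Merge us vs u u′ v v′ → Merge (as ++ us) vs a u′ v v′
  extend-merge {as} {us} {vs} {q = q} t qu qv M = record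
    { trail = join t (to-start (start∈ M)) (trail M)
    ; start∈ = inj₁ ≡.refl
    ; finish∈ = finish∈ M
    ; few = few M
    ; perm = ↭-trans (↭-reflexive (++-assoc as (route M) (dropped M)))
               (↭-trans (++⁺ˡ as (perm M)) (↭-reflexive (≡.sym (++-assoc as us vs))))
    }
    where
    to-start : ∀ {s} → s ≡ _ ⊎ s ≡ _ → q ~ s
    to-start (inj₁ ≡.refl) = qu
    to-start (inj₂ ≡.refl) = qv

  merge-concat : ∀ {us vs u u′ v v′} → Trail u us u′ → u′ ~ v → Trail v vs v′ → Merge us vs u u′ v v′
  merge-concat {us} {vs} s e t = record
    { trail = join s e t ; start∈ = inj₁ ≡.refl ; finish∈ = inj₂ ≡.refl
    ; few = z≤n ; perm = ↭-reflexive (++-identityʳ (us ++ vs)) }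

  merge-drop : ∀ {us u u′ v v′} → Trail u us u′ → Merge us (v ∷ []) u u′ v v′
  merge-drop {us} t = record
    { trail = t ; start∈ = inj₁ ≡.refl ; finish∈ = inj₁ ≡.refl
    ; few = s≤s z≤n ; perm = ↭-refl }

  -- Spiders, layers and merging

  module _ (noSpider : Free K13ss G) (noTriangle : Free K3 G) where

    tri : ∀ {a b c} → a ~ b → b ~ c → a ≁ c
    tri = triangle-free noTriangle

    -- K₁,₃** has ten non-edges; the five not mentioned here follow from triangle-freeness.
    spider : ∀ {c a a′ b b′ l} → c ~ a → a ~ a′ → c ~ b → b ~ b′ → c ~ l →
      a ≁ b′ → b ≁ a′ → a′ ≁ b′ → l ≁ a′ → l ~ b′
    spider {c} {a} {a′} {b} {b′} {l} ca aa′ cb bb′ cl ab′ ba′ a′b′ la′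
      with edge? l b′
    ... | yes lb′ = lb′
    ... | no lb′ = ⊥-elim (noSpider (inducedSub {H = K13ss} {G} (from-yes (separating? K13ss))
                     (Vec.lookup (c ∷ a ∷ b ∷ l ∷ a′ ∷ b′ ∷ [])) table))
      where
      ca′ = non-edge (tri ca aa′)
      cb′ = non-edge (tri cb bb′)
      ab = non-edge (tri (edge-sym ca) cb)
      al = non-edge (tri (edge-sym ca) cl)
      bl = non-edge (tri (edge-sym cb) cl)
      flip : ∀ {u v β} → adj G u v ≡ β → adj G v u ≡ β
      flip {u} {v} e = ≡.trans (Graph.sym G v u) e
      table : ∀ i j → _
      table 0F 0F = irrefl G c
      table 0F 1F = ca
      table 0F 2F = cb
      table 0F 3F = cl
      table 0F 4F = ca′
      table 0F 5F = cb′
      table 1F 0F = flip ca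
      table 1F 1F = irrefl G a
      table 1F 2F = ab
      table 1F 3F = al
      table 1F 4F = aa′
      table 1F 5F = non-edge ab′
      table 2F 0F = flip cb
      table 2F 1F = flip ab
      table 2F 2F = irrefl G b
      table 2F 3F = bl
      table 2F 4F = non-edge ba′
      table 2F 5F = bb′
      table 3F 0F = flip cl
      table 3F 1F = flip al
      table 3F 2F = flip bl
      table 3F 3F = irrefl G l
      table 3F 4F = non-edge la′
      table 3F 5F = non-edge lb′
      table 4F 0F = flip ca′
      table 4F 1F = flip aa′
      table 4F 2F = flip (non-edge ba′)
      table 4F 3F = flip (non-edge la′)
      table 4F 4F = irrefl G a′
      table 4F 5F = non-edge a′b′
      table 5F 0F = flip cb′
      table 5F 1F = flip (non-edge ab′)
      table 5F 2F = flip bb′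
      table 5F 3F = flip (non-edge lb′)
      table 5F 4F = flip (non-edge a′b′)
      table 5F 5F = irrefl G b′

    -- `c₁` and `c₂` will form one long arm of a spider; this supplies the non-edges to that arm.
    Far : Fin n → Fin n → Fin n → Set
    Far c₁ c₂ v = c₁ ≁ v × c₂ ≁ v

    -- The spider centred at `c₀` with long arms `c₁`, `c₂` and `w`, `w′` and short arm `z`. Hence
    -- far neighbours of `c₀` have the same far neighbours, which is the complete joining of
    -- consecutive layers.
    twin : ∀ {c₀ c₁ c₂ z w w′} → c₁ ~ c₀ → c₂ ~ c₁ → c₀ ~ z → c₀ ~ w → w ~ w′ →
      Far c₁ c₂ z → Far c₁ c₂ w → Far c₁ c₂ w′ → z ~ w′
    twin c₁c₀ c₂c₁ c₀z c₀w ww′ (_ , c₂z) (_ , c₂w) (c₁w′ , c₂w′) =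
      spider (edge-sym c₁c₀) (edge-sym c₂c₁) c₀w ww′ c₀z
        c₁w′ (c₂w ∘ edge-sym) c₂w′ (c₂z ∘ edge-sym)

    -- When the trail returns to a neighbour `b` of `c₀`, the vertex `q` before `b` is adjacent to
    -- `v` by `twin`. The part up to `q` can therefore precede any merge of the remainder with the
    -- other trail.
    merge-at-return : ∀ {c₀ c₁ c₂ u as b bs u′ v vs v′} →
      c₁ ~ c₀ → c₂ ~ c₁ → c₀ ~ v → c₀ ~ b →
      Trail u (u ∷ as ++ b ∷ bs) u′ → All (Far c₁ c₂) (u ∷ as ++ b ∷ bs) → Far c₁ c₂ v →
      (Trail b (b ∷ bs) u′ → All (Far c₁ c₂) (b ∷ bs) → Merge (b ∷ bs) vs b u′ v v′) →
      Merge (u ∷ as ++ b ∷ bs) vs u u′ v v′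
    merge-at-return {u = u} {as} c₁c₀ c₂c₁ c₀v c₀b s fu fv rec with cut u as s | All.++⁻ (u ∷ as) fu
    ... | q , s₁ , qb , s₂ | fas , fbs =
      extend-merge s₁ qb
        (edge-sym (twin c₁c₀ c₂c₁ c₀v c₀b (edge-sym qb)
          fv (All.head fbs) (All.lookup fas (last∈ s₁))))
        (rec s₂ fbs)

    -- No vertex of either trail returns to c₀.  Up to their last neighbours b and b′ of u the
    -- two trails can be traversed one after the other, and both b and b′ are joined to the
    -- heads of both remainders.
    merge-past-neighbours : ∀ {c₀ c₁ c₂ u as b bs u′ v as′ b′ bs′ v′} →
      c₁ ~ c₀ → c₂ ~ c₁ → c₀ ~ u → c₀ ~ v → u ~ b → u ~ b′ →
      Trail u (u ∷ as ++ b ∷ bs) u′ → Trail v (v ∷ as′ ++ b′ ∷ bs′) v′ →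
      All (Far c₁ c₂) (u ∷ as ++ b ∷ bs) → All (Far c₁ c₂) (v ∷ as′ ++ b′ ∷ bs′) →
      All (c₀ ≁_) (as ++ b ∷ bs) → All (c₀ ≁_) (as′ ++ b′ ∷ bs′) →
      All (u ≁_) bs → All (u ≁_) bs′ →
      (∀ {w ws w′ ws′} → bs ≡ w ∷ ws → bs′ ≡ w′ ∷ ws′ → b ~ w → b ~ w′ →
         Trail w (w ∷ ws) u′ → Trail w′ (w′ ∷ ws′) v′ →
         All (Far u c₀) (w ∷ ws) → All (Far u c₀) (w′ ∷ ws′) →
         Merge (w ∷ ws) (w′ ∷ ws′) w u′ w′ v′) →
      Merge (u ∷ as ++ b ∷ bs) (v ∷ as′ ++ b′ ∷ bs′) u u′ v v′
    merge-past-neighbours {c₀} {c₁} {c₂} {u} {as} {b} {bs} {u′} {v} {as′} {b′} {bs′} {v′}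
      c₁c₀ c₂c₁ c₀u c₀v ub ub′ s t fu fv c₀us c₀vs ubs ubs′ rec
      with cut u as s | cut v as′ t
    ... | q , s₁ , qb , s₂ | q′ , t₁ , q′b′ , t₂ = cases bs bs′ s₂ t₂ ≡.refl ≡.refl
      where
      far-b : Far c₁ c₂ b
      far-b = All.head (All.++⁻ʳ (u ∷ as) fu)
      bv : b ~ v
      bv = edge-sym (twin c₁c₀ c₂c₁ c₀v c₀u ub (All.head fv) (All.head fu) far-b)
      A A′ : List (Fin n)
      A = u ∷ as ++ [ b ]
      A′ = v ∷ as′ ++ [ b′ ]
      cases : ∀ cs cs′ → Trail b (b ∷ cs) u′ → Trail b′ (b′ ∷ cs′) v′ → cs ≡ bs → cs′ ≡ bs′ →
        Merge (u ∷ as ++ b ∷ bs) (v ∷ as′ ++ b′ ∷ bs′) u u′ v v′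
      -- If one trail stops at `b` or `b′`, concatenation suffices, as `b` is adjacent to `v` and
      -- `b′` to `u`.
      cases [] _ end _ _ _ = merge-concat s bv t
      cases (_ ∷ _) [] _ end _ _ = swap-merge (merge-concat t (edge-sym ub′) s)
      cases (w ∷ ws) (w′ ∷ ws′) s₂ t₂ ≡.refl ≡.refl with uncons s₂ | uncons t₂
      ... | bw , s₃ | b′w′ , t₃ = record
        { trail = join (join s₁ qb end) bv
                    (join (join t₁ q′b′ end) (b′~start (start∈ M)) (trail M))
        ; start∈ = inj₁ ≡.refl
        ; finish∈ = finish∈ M
        ; dropped = dropped M
        ; few = few M
        ; perm = ↭-trans (++-interleave A A′ {route M} {dropped M} {w ∷ ws} {w′ ∷ ws′} (perm M))
                   (↭-reflexive (≡.cong₂ _++_ (++-assoc (u ∷ as) [ b ] (w ∷ ws))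
                                              (++-assoc (v ∷ as′) [ b′ ] (w′ ∷ ws′))))
        }
        where
        c₀bs : All (c₀ ≁_) (b ∷ w ∷ ws)
        c₀bs = All.++⁻ʳ as c₀us
        c₀bs′ : All (c₀ ≁_) (b′ ∷ w′ ∷ ws′)
        c₀bs′ = All.++⁻ʳ as′ c₀vs
        far₁ : ∀ {z zs} → All (c₀ ≁_) zs → All (Far c₁ c₂) zs → z ∈ zs → Far c₀ c₁ z
        far₁ p f z∈ = All.lookup p z∈ , proj₁ (All.lookup f z∈)
        fbs : ∀ {z} → z ∈ b ∷ w ∷ ws → Far c₀ c₁ z
        fbs = far₁ c₀bs (All.++⁻ʳ (u ∷ as) fu)
        fbs′ : ∀ {z} → z ∈ b′ ∷ w′ ∷ ws′ → Far c₀ c₁ z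
        fbs′ = far₁ c₀bs′ (All.++⁻ʳ (v ∷ as′) fv)
        -- `twin` one layer further out: the centre is `u` and the arm is `c₀`, `c₁`.
        bw′ : b ~ w′
        bw′ = twin c₀u c₁c₀ ub ub′ b′w′
                (fbs (here ≡.refl)) (fbs′ (here ≡.refl)) (fbs′ (there (here ≡.refl)))
        b′w : b′ ~ w
        b′w = twin c₀u c₁c₀ ub′ ub bw
                (fbs′ (here ≡.refl)) (fbs (here ≡.refl)) (fbs (there (here ≡.refl)))
        M : Merge (w ∷ ws) (w′ ∷ ws′) w u′ w′ v′
        M = rec ≡.refl ≡.refl bw bw′ s₃ t₃
              (All.zip (ubs , All.tail c₀bs)) (All.zip (ubs′ , All.tail c₀bs′))
        b′~start : ∀ {z} → z ≡ w ⊎ z ≡ w′ → b′ ~ z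
        b′~start (inj₁ ≡.refl) = b′w
        b′~start (inj₂ ≡.refl) = b′w′

    -- Induction on the total length, bounded by `m`. Returns to the neighbourhood of `c₀` are
    -- removed first; without any, both trails advance past the layer of neighbours of `u`.
    merge : ∀ m {c₀ c₁ c₂ u us u′ v vs v′} → length us + length vs < m →
      c₁ ~ c₀ → c₂ ~ c₁ → c₀ ~ u → c₀ ~ v →
      Trail u (u ∷ us) u′ → Trail v (v ∷ vs) v′ →
      All (Far c₁ c₂) (u ∷ us) → All (Far c₁ c₂) (v ∷ vs) →
      Merge (u ∷ us) (v ∷ vs) u u′ v v′
    merge (suc m) {c₀} {u = u} {us} {v = v} {vs} (s≤s lt) c₁c₀ c₂c₁ c₀u c₀v s t fu fv
      with Any.any? (edge? c₀) us | Any.any? (edge? c₀) vs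
    ... | yes p | _ with split-first (edge? c₀) p
    ...   | as , b , bs , ≡.refl , c₀b , _ =
      merge-at-return c₁c₀ c₂c₁ c₀v c₀b s fu (All.head fv) λ s′ fbs →
        merge m (<-≤-trans (+-monoˡ-< (length vs) (suffix-< as)) lt)
          c₁c₀ c₂c₁ c₀b c₀v s′ t fbs fv
    merge (suc m) {c₀} {u = u} {us} (s≤s lt) c₁c₀ c₂c₁ c₀u c₀v s t fu fv
        | no _ | yes p with split-first (edge? c₀) p
    ...   | as , b , bs , ≡.refl , c₀b , _ =
      swap-merge (merge-at-return c₁c₀ c₂c₁ c₀u c₀b t fv (All.head fu) λ t′ fbs →
        swap-merge (merge m (<-≤-trans (+-monoʳ-< (length us) (suffix-< as)) lt)
          c₁c₀ c₂c₁ c₀u c₀b s t′ fu fbs))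
    -- A trail consisting of one vertex is simply dropped, which ends the recursion, so at most one
    -- vertex is lost overall.
    merge (suc m) {us = []} (s≤s lt) c₁c₀ c₂c₁ c₀u c₀v s t fu fv | no _ | no _ =
      swap-merge (merge-drop t)
    merge (suc m) {us = _ ∷ _} {vs = []} (s≤s lt) c₁c₀ c₂c₁ c₀u c₀v s t fu fv | no _ | no _ =
      merge-drop s
    merge (suc m) {c₀} {u = u} {us = u₂ ∷ us} {u′} {v = v} {vs = v₂ ∷ vs} {v′}
      (s≤s lt) c₁c₀ c₂c₁ c₀u c₀v s t fu fv | no ¬p | no ¬q
      with uncons s | uncons t
    ... | uu₂ , _ | vv₂ , _
      -- Each remainder contains a neighbour of `u`, namely its first vertex: `u₂` by the trail,
      -- `v₂` by `twin`.
      with split-last (edge? u) {u₂ ∷ us} (here uu₂)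
         | split-last (edge? u) {v₂ ∷ vs} (here (twin c₁c₀ c₂c₁ c₀u c₀v vv₂
             (All.head fu) (All.head fv) (All.head (All.tail fv))))
    ... | as , b , bs , eq , ub , ¬bs | as′ , b′ , bs′ , eq′ , ub′ , ¬bs′ =
      ≡.subst₂ (λ xs ys → Merge (u ∷ xs) (v ∷ ys) u u′ v v′) (≡.sym eq) (≡.sym eq′)
        (merge-past-neighbours c₁c₀ c₂c₁ c₀u c₀v ub ub′
          (≡.subst (λ xs → Trail u (u ∷ xs) u′) eq s) (≡.subst (λ xs → Trail v (v ∷ xs) v′) eq′ t)
          (≡.subst (λ xs → All _ (u ∷ xs)) eq fu) (≡.subst (λ xs → All _ (v ∷ xs)) eq′ fv)
          (≡.subst (All _) eq (¬Any⇒All¬ _ ¬p)) (≡.subst (All _) eq′ (¬Any⇒All¬ _ ¬q))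
          ¬bs ¬bs′
          -- The centre moves two layers out: `b`, `u`, `c₀` take the places of `c₀`, `c₁`, `c₂`.
          λ { ≡.refl ≡.refl bw bw′ s′ t′ f f′ → merge m
                (<-≤-trans (+-mono-< (shorter as eq) (shorter as′ eq′)) lt)
                ub c₀u bw bw′ s′ t′ f f′ })

    -- If `x` is adjacent to `t`, then `t` and `u` are twins with respect to the centre `x`.
    -- Otherwise the spider centred at `u` has long arms `x`, `p` and `w`, `t` and short arm `v`.
    pentagon : ∀ {x p p′ u v w t} → p ~ x → p′ ~ p → x ~ u → u ~ v → u ~ w → w ~ t →
      Far p p′ u → Far p p′ v → Far p p′ w → Far p p′ t → v ~ t
    pentagon {x} {t = t} px p′p xu uv uw wt fu fv fw ft with edge? x t
    ... | yes xt = edge-sym (twin px p′p xt xu uv ft fu fv)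
    ... | no xt = spider (edge-sym xu) (edge-sym px) uw wt uv
                    xt (proj₁ fw ∘ edge-sym) (proj₁ ft) (proj₁ fv ∘ edge-sym)

    -- By `pentagon`, the vertices along either trail are alternately adjacent to `u` and to `v`.
    -- What decides the merge is which of the two each last vertex is adjacent to.
    merge-adjacent : ∀ {x₁ x₂ p p′ u us u′ v vs v′} →
      p ~ x₁ → p ~ x₂ → p′ ~ p → x₁ ~ u → x₂ ~ v → u ~ v →
      Trail u (u ∷ us) u′ → Trail v (v ∷ vs) v′ →
      All (Far p p′) (u ∷ us) → All (Far p p′) (v ∷ vs) →
      Merge (u ∷ us) (v ∷ vs) u u′ v v′
    merge-adjacent {p = p} {p′} {u} {us} {u′} {v} {vs} {v′}
      px₁ px₂ p′p x₁u x₂v uv s t fu@(fu₀ ∷ _) fv@(fv₀ ∷ _) =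
      decide vs t fv (alternate s fu (inj₂ vu)) (alternate t fv (inj₁ uv))
      where
      vu = edge-sym uv
      alternate : ∀ {a xs b} → Trail a xs b → All (Far p p′) xs → u ~ a ⊎ v ~ a → u ~ b ⊎ v ~ b
      alternate end _ ua = ua
      alternate (e ∷ r) (fa ∷ fs) (inj₁ ua) = alternate r fs
        (inj₂ (pentagon px₁ p′p x₁u uv ua e fu₀ fv₀ fa (All.lookup fs (first∈ r))))
      alternate (e ∷ r) (fa ∷ fs) (inj₂ va) = alternate r fs
        (inj₁ (pentagon px₂ p′p x₂v vu va e fv₀ fu₀ fa (All.lookup fs (first∈ r))))
      decide : ∀ vs → Trail v (v ∷ vs) v′ → All (Far p p′) (v ∷ vs) →
        u ~ u′ ⊎ v ~ u′ → u ~ v′ ⊎ v ~ v′ → Merge (u ∷ us) (v ∷ vs) u u′ v v′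
      decide _ t _ (inj₂ vu′) _ = merge-concat s (edge-sym vu′) t
      decide _ t _ (inj₁ _) (inj₁ uv′) = swap-merge (merge-concat t (edge-sym uv′) s)
      decide [] _ _ (inj₁ _) (inj₂ _) = merge-drop s
      -- Neither concatenation is at hand, so `v` is skipped: `u′` and `v` are both neighbours of
      -- `u`, and `pentagon` makes `u′` adjacent to `v₂`.
      decide (v₂ ∷ vs) t (_ ∷ fv₂ ∷ _) (inj₁ uu′) (inj₂ _) with uncons t
      ... | vv₂ , t₂ = record
        { trail = join s (pentagon px₁ p′p x₁u uu′ uv vv₂ fu₀ (All.lookup fu (last∈ s)) fv₀ fv₂) t₂
        ; start∈ = inj₁ ≡.refl
        ; finish∈ = inj₂ ≡.refl
        ; few = s≤s z≤n
        ; perm = ↭-trans (↭-reflexive (++-assoc (u ∷ us) (v₂ ∷ vs) [ v ]))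
                   (++⁺ˡ (u ∷ us) (++-comm (v₂ ∷ vs) [ v ]))
        }

    -- Inserting a path into a longest cycle

    module _
      {zs₀ : List (Fin n)} (unique : Unique zs₀) (closed : Closed zs₀)
      (maximal : ∀ {a b zs} → Trail a zs b → b ~ a → Unique zs → length zs ≤ length zs₀)
      {p₁ p₂ pₖ : Fin n} {ps : List (Fin n)} (bridge : Trail p₁ ps pₖ) (bridge-unique : Unique ps)
      (long : 2 ≤ length ps) (off : All (_∉ zs₀) ps) (p₁p₂ : p₁ ~ p₂)
      (p₂-nbrs : ∀ {c} → c ∈ zs₀ → p₂ ~ c → pₖ ~ c)
      where

      -- Closing `zs` through the bridge loses at most one vertex and gains at least two, which
      -- contradicts maximality.
      absorb : ∀ {a b zs ds} → Trail a zs b → p₁ ~ a → pₖ ~ b → zs ++ ds ↭ zs₀ → length ds ≤ 1 → ⊥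
      absorb {zs = zs} {ds} t p₁a pₖb p ds≤1 = 1+n≰n (begin
        suc (length zs₀)                                ≤⟨ +-cancelʳ-≤ 1 _ _ (begin
          suc (length zs₀) + 1                            ≡⟨ +-suc (length zs₀) 1 ⟨
          length zs₀ + 2                                  ≤⟨ +-monoʳ-≤ (length zs₀) long ⟩
          length zs₀ + length ps                          ≡⟨ length-++ zs₀ ⟨
          length (zs₀ ++ ps)                              ≡⟨ ↭-length perm′ ⟨
          length ((zs ++ reverse ps) ++ ds)               ≡⟨ length-++ (zs ++ reverse ps) ⟩
          length (zs ++ reverse ps) + length ds           ≤⟨ +-monoʳ-≤ _ ds≤1 ⟩
          length (zs ++ reverse ps) + 1                   ∎) ⟩
        length (zs ++ reverse ps)                       ≤⟨ maximal
            (join t (edge-sym pₖb) (reverse-trail bridge)) p₁a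
            (unique-++⁻ˡ _ (unique-resp-↭ (↭-sym perm′)
              (Unique.++⁺ unique bridge-unique λ (∈zs₀ , ∈ps) → All.lookup off ∈ps ∈zs₀))) ⟩
        length zs₀                                      ∎)
        where
        open ≤-Reasoning
        perm′ : (zs ++ reverse ps) ++ ds ↭ zs₀ ++ ps
        perm′ = ↭-trans (↭-reflexive (++-assoc zs (reverse ps) ds))
          (↭-trans (++⁺ˡ zs (++-comm (reverse ps) ds))
          (↭-trans (↭-reflexive (≡.sym (++-assoc zs ds (reverse ps))))
          (++⁺ p (↭-reverse ps))))

      private
        FarP = Far p₁ p₂
        p₂p₁ = edge-sym p₁p₂

      merge-segments : ∀ {x₁ x₂ u us u′ v vs v′} → p₁ ~ x₁ → p₁ ~ x₂ → x₁ ~ u → x₂ ~ v →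
        Trail u (u ∷ us) u′ → Trail v (v ∷ vs) v′ → All FarP (u ∷ us) → All FarP (v ∷ vs) →
        Merge (u ∷ us) (v ∷ vs) u u′ v v′
      merge-segments {x₁} {x₂} {u} {v = v} p₁x₁ p₁x₂ x₁u x₂v s t fu fv
        with edge? x₂ u | edge? x₁ v | edge? u v
      ... | yes x₂u | _ | _ = merge _ ≤-refl p₁x₂ p₂p₁ x₂u x₂v s t fu fv
      ... | no _ | yes x₁v | _ = merge _ ≤-refl p₁x₁ p₂p₁ x₁u x₁v s t fu fv
      ... | no _ | no _ | yes uv = merge-adjacent p₁x₁ p₁x₂ p₂p₁ x₁u x₂v uv s t fu fv
      -- The spider centred at `p₁` with long arms `x₁`, `u` and `x₂`, `v` and short arm `p₂` would
      -- make `p₂` adjacent to `v`.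
      ... | no x₂u | no x₁v | no uv = ⊥-elim (proj₂ (All.head fv)
        (spider p₁x₁ x₁u p₁x₂ x₂v p₁p₂ x₁v x₂u uv (proj₂ (All.head fu))))

      arrangement-⊥ : ∀ {x xs js y ys us} →
        Closed (x ∷ xs ++ js ++ y ∷ ys ++ us) → x ∷ xs ++ js ++ y ∷ ys ++ us ↭ zs₀ →
        Ends (p₁ ~_) (x ∷ xs) → Ends (pₖ ~_) (y ∷ ys) → All FarP js → All FarP us → ⊥
      -- If `J` or `U` is empty, the cycle can be opened there between an end of `X` and an end of
      -- `Y`, and no vertex is lost.
      arrangement-⊥ {x} {xs} {[]} {y} {ys} {us} (a , e , t , ea) p endsX endsY _ _
        with cut x xs t
      ... | x₂ , tX , _ , t₂ with prefix us t₂
      ...   | _ , tY =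
        absorb (reverse-trail (join t₂ ea tX)) (proj₂ (endsX tX)) (proj₁ (endsY tY))
          (↭-trans (↭-reflexive (++-identityʳ _)) (↭-trans (↭-reverse _)
            (↭-trans (++-comm (y ∷ ys ++ us) (x ∷ xs)) p))) z≤n
      arrangement-⊥ {x} {xs} {js@(_ ∷ _)} {y} {ys} {[]} (a , e , t , ea) p endsX endsY _ _
        with prefix (js ++ y ∷ ys ++ []) t
           | subst (λ l → Trail y (y ∷ l) e) (++-identityʳ ys)
               (suffix (x ∷ xs ++ js)
                 (subst (λ l → Trail a l e) (≡.sym (++-assoc (x ∷ xs) js (y ∷ ys ++ []))) t))
      ... | _ , tX | tY =
        absorb t (proj₁ (endsX tX)) (proj₂ (endsY tY)) (↭-trans (↭-reflexive (++-identityʳ _)) p) z≤n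
      arrangement-⊥ {x} {xs} {v ∷ js} {y} {ys} {u₀ ∷ us} (a , u , t , ua) p endsX endsY fJ fU
        with cut x xs t
      ... | x₂ , tX , x₂v , t₂ with cut v js t₂
      ...   | j , tJ , jy , t₃ with cut y ys t₃
      ...     | y₂ , tY , y₂u₀ , tU = close (start∈ M) (finish∈ M)
        where
        X = x ∷ xs
        J = v ∷ js
        Y = y ∷ ys
        U = u₀ ∷ us
        -- Reversed, `U` leads from `X` to `Y` as `J` does.
        rU : Trail u (reverse U) u₀
        rU = reverse-trail tU
        M : Merge (reverse U) J u u₀ v j
        M with trail-∷ rU
        ... | _ , eq = subst (λ l → Merge l J u u₀ v j) (≡.sym eq)
          (merge-segments (proj₁ (endsX tX)) (proj₂ (endsX tX)) (edge-sym ua) x₂v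
            (subst (λ l → Trail u l u₀) eq rU) tJ
            (subst (All FarP) eq (All-resp-↭ (↭-sym (↭-reverse U)) fU)) fJ)
        total : ∀ {Xo Yo} → Xo ↭ X → Yo ↭ Y → (Xo ++ (route M ++ Yo)) ++ dropped M ↭ zs₀
        total {Xo} {Yo} pX pY = begin
          (Xo ++ (W ++ Yo)) ++ D     ≡⟨ ++-assoc Xo (W ++ Yo) D ⟩
          Xo ++ ((W ++ Yo) ++ D)     ≡⟨ cong (Xo ++_) (++-assoc W Yo D) ⟩
          Xo ++ (W ++ (Yo ++ D))     ↭⟨ ++⁺ˡ Xo (++⁺ˡ W (++-comm Yo D)) ⟩
          Xo ++ (W ++ (D ++ Yo))     ≡⟨ cong (Xo ++_) (++-assoc W D Yo) ⟨
          Xo ++ ((W ++ D) ++ Yo)     ↭⟨ ++⁺ pX (++⁺ (↭-trans (perm M) (++⁺ʳ J (↭-reverse U))) pY) ⟩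
          X ++ ((U ++ J) ++ Y)       ≡⟨ cong (X ++_) (++-assoc U J Y) ⟩
          X ++ (U ++ (J ++ Y))       ↭⟨ ++⁺ˡ X (++-comm U (J ++ Y)) ⟩
          X ++ ((J ++ Y) ++ U)       ≡⟨ cong (X ++_) (++-assoc J Y U) ⟩
          X ++ (J ++ (Y ++ U))       ↭⟨ p ⟩
          zs₀                        ∎
          where
          open PermutationReasoning
          W = route M
          D = dropped M
        -- `X` and `Y` are run in whichever direction fits the ends of the merge; both ends of `X`
        -- are neighbours of `p₁` and both ends of `Y` of `pₖ`, so either direction will do.
        close : start M ≡ u ⊎ start M ≡ v → finish M ≡ u₀ ⊎ finish M ≡ j → ⊥
        close s f with start-side s | finish-side f
          where
          start-side : ∀ {z} → z ≡ u ⊎ z ≡ v →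
            ∃₂ λ b Xo → ∃ λ c → Trail b Xo c × p₁ ~ b × c ~ z × Xo ↭ X
          start-side (inj₁ ≡.refl) =
            _ , _ , _ , reverse-trail tX , proj₂ (endsX tX) , edge-sym ua , ↭-reverse X
          start-side (inj₂ ≡.refl) = _ , _ , _ , tX , proj₁ (endsX tX) , x₂v , ↭-refl
          finish-side : ∀ {z} → z ≡ u₀ ⊎ z ≡ j →
            ∃₂ λ b Yo → ∃ λ c → Trail b Yo c × z ~ b × pₖ ~ c × Yo ↭ Y
          finish-side (inj₁ ≡.refl) =
            _ , _ , _ , reverse-trail tY , edge-sym y₂u₀ , proj₁ (endsY tY) , ↭-reverse Y
          finish-side (inj₂ ≡.refl) = _ , _ , _ , tY , jy , proj₂ (endsY tY) , ↭-refl
        ... | _ , _ , _ , tXo , p₁b , cs , pX | _ , _ , _ , tYo , fb , pₖc , pY =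
          absorb (join tXo cs (join (trail M) fb tYo)) p₁b pₖc (total pX pY) (few M)

      -- The cycle is read from `y₀`. `X` spans the neighbours of `p₁` other than `y₀`; in the
      -- complementary arc, which contains `y₀`, `Y` spans the neighbours of `pₖ`. What is left of
      -- that arc before and after `Y` is `J` and `U`.
      no-bridge : ∀ {x₀ y₀} → x₀ ∈ zs₀ → y₀ ∈ zs₀ → x₀ ≢ y₀ → p₁ ~ x₀ → pₖ ~ y₀ → ⊥
      no-bridge {x₀} {y₀} x₀∈ y₀∈ x₀≢y₀ p₁x₀ pₖy₀ with ∈-∃++ y₀∈
      ... | α , β , eq = go (span A? A-here)
        where
        -- y₀ may be a neighbour of p₁ as well; it must end up in Y, not in X.
        A : Pred (Fin n) 0ℓ
        A v = p₁ ~ v × v ≢ y₀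
        A? : Decidable A
        A? v = edge? p₁ v ×-dec ¬? (v Fin.≟ y₀)
        x₀∈′ : x₀ ∈ β ++ α
        x₀∈′ with ∈-++⁻ α (subst (x₀ ∈_) eq x₀∈)
        ... | inj₁ ∈α = ∈-++⁺ʳ β ∈α
        ... | inj₂ (here x₀≡y₀) = ⊥-elim (x₀≢y₀ x₀≡y₀)
        ... | inj₂ (there ∈β) = ∈-++⁺ˡ ∈β
        A-here : Any A (β ++ α)
        A-here = Any.map (λ { ≡.refl → p₁x₀ , x₀≢y₀ }) x₀∈′
        go : (∃₂ λ us x → ∃₂ λ xs js → β ++ α ≡ us ++ (x ∷ xs) ++ js ×
               All (¬_ ∘ A) us × All (¬_ ∘ A) js × Ends A (x ∷ xs)) → ⊥
        go (us , x , xs , js , eq₁ , ¬us , ¬js , endsX)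
          with span (edge? pₖ) {js ++ y₀ ∷ us} (Any.++⁺ʳ js (here pₖy₀))
        ... | js′ , y , ys , us′ , eq₂ , ¬js′ , ¬us′ , endsY =
          arrangement-⊥ {x} {xs} {js′} {y} {ys} {us′}
            (subst Closed eq₃ (rotate (y₀ ∷ us) (x ∷ xs ++ js)
              (subst Closed (cong (y₀ ∷_) eq₁) (rotate α (y₀ ∷ β) (subst Closed eq closed)))))
            perm₀
            (λ t → proj₁ (proj₁ (endsX t)) , proj₁ (proj₂ (endsX t))) endsY
            (All.tabulate λ v∈ → far (∈-++⁺ˡ v∈) (All.lookup ¬js′ v∈))
            (All.tabulate λ v∈ → far (∈-++⁺ʳ js′ (∈-++⁺ʳ (y ∷ ys) v∈)) (All.lookup ¬us′ v∈))
          where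
          eq₃ : (x ∷ xs ++ js) ++ (y₀ ∷ us) ≡ x ∷ xs ++ js′ ++ y ∷ ys ++ us′
          eq₃ = ≡.trans (++-assoc (x ∷ xs) js (y₀ ∷ us)) (cong ((x ∷ xs) ++_) eq₂)
          perm₀ : x ∷ xs ++ js′ ++ y ∷ ys ++ us′ ↭ zs₀
          perm₀ = ↭-trans (↭-reflexive (≡.sym eq₃))
            (↭-trans (++-comm (x ∷ xs ++ js) (y₀ ∷ us))
            (↭-trans (↭-reflexive (cong (y₀ ∷_) (≡.sym eq₁)))
            (↭-trans (++-comm (y₀ ∷ β) α) (↭-reflexive (≡.sym eq)))))
          ¬A : All (¬_ ∘ A) (js ++ y₀ ∷ us)
          ¬A = All.++⁺ ¬js ((λ (_ , y₀≢y₀) → y₀≢y₀ ≡.refl) ∷ ¬us)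
          -- Outside `X` only `y₀` can be a neighbour of `p₁`, and `y₀` is a neighbour of `pₖ`; so
          -- is every neighbour of `p₂` on the cycle.
          far : ∀ {v} → v ∈ js′ ++ (y ∷ ys) ++ us′ → pₖ ≁ v → FarP v
          far {v} v∈ pₖv =
            (λ p₁v → All.lookup ¬A (subst (v ∈_) (≡.sym eq₂) v∈)
                       (p₁v , λ { ≡.refl → pₖv pₖy₀ })) ,
            (λ p₂v → pₖv (p₂-nbrs (∈-resp-↭ perm₀ (∈-++⁺ʳ (x ∷ xs) v∈)) p₂v))

    -- Domination by a longest cycle

    module _ (twoConnected : TwoConnected G) (C : Cycle G) (maximal : LongestCycle G C) where

      private
        zs : List (Fin n)
        zs = verts C

        Off : Fin n → Set
        Off v = v ∉ zs

        _∈?_ = DecMembership._∈?_ {A = Fin n} Fin._≟_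

        connected = proj₁ (proj₂ twoConnected)
        connected-minus = proj₂ (proj₂ twoConnected)

      bound : ∀ {a b xs} → Trail a xs b → b ~ a → Unique xs → length xs ≤ length zs
      bound {xs = xs} t e u with 3 ≤? length xs
      ... | yes l = maximal (closed⇒cycle u l (_ , _ , t , e))
      -- Too short to be a cycle, hence also shorter than `C`.
      ... | no l≱3 = ≤-trans (<⇒≤ (≰⇒> l≱3)) (Cycle.long C)

      -- The bridge is the edge itself, with `p₂` and `pₖ` both equal to `h′`. Triangle-freeness
      -- makes `c` and `c′` distinct.
      attached-edge-⊥ : ∀ {h h′ c c′} → h ~ h′ → Off h → Off h′ →
        h ~ c → h′ ~ c′ → c ∈ zs → c′ ∈ zs → ⊥
      attached-edge-⊥ hh′ h∉ h′∉ hc h′c′ c∈ c′∈ =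
        no-bridge (distinct C) (cycle-closed C) bound (hh′ ∷ end)
          ((edge⇒≢ hh′ ∷ []) ∷ [] ∷ []) ≤-refl (h∉ ∷ h′∉ ∷ []) hh′ (λ _ e → e)
          c∈ c′∈ (λ { ≡.refl → tri hh′ h′c′ hc }) hc h′c′

      -- The second vertex of the bridge has no neighbour on `C`: otherwise the first edge of the
      -- bridge would contradict `attached-edge-⊥`.
      attached-walk-⊥ : ∀ {h h′ c c′} → WalkIn G Off h h′ → h ≢ h′ →
        h ~ c → h′ ~ c′ → c ∈ zs → c′ ∈ zs → c ≢ c′ → ⊥
      attached-walk-⊥ s h≢h′ hc h′c′ c∈ c′∈ c≢c′ with walk⇒trail s
      ... | _ , end , _ , _ = h≢h′ ≡.refl
      ... | _ , t@(hp ∷ r) , u , offs =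
        no-bridge (distinct C) (cycle-closed C) bound t u (trail-length≥2 t h≢h′) offs hp
          (λ c″∈ pc″ → ⊥-elim (attached-edge-⊥ hp (All.head offs)
            (All.lookup (All.tail offs) (first∈ r)) hc pc″ c∈ c″∈))
          c∈ c′∈ c≢c′ hc h′c′

      -- The place where a walk from `u` first meets `C`. `Q` remembers, for its last vertex off `C`
      -- and first vertex on `C`, which vertex the walk avoided.
      record Attachment (Q : Fin n → Set) (u : Fin n) : Set where
        constructor attach
        field
          {h c} : Fin n
          walk  : WalkIn G Off u h
          edge  : h ~ c
          c∈zs  : c ∈ zs
          Qh    : Q h
          Qc    : Q c
      open Attachment

      attachment : ∀ {Q u v} → WalkIn G Q u v → Off u → v ∈ zs → Attachment Q u
      attachment (here _) u∉ u∈ = ⊥-elim (u∉ u∈)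
      attachment (step {w = w} q e s) u∉ v∈ with w ∈? zs
      ... | yes w∈ = attach (here u∉) e w∈ q (walk-start s)
      ... | no w∉ with attachment s w∉ v∈
      ...   | attach s′ e′ c∈ qh qc = attach (step u∉ e s′) e′ c∈ qh qc

      walk-end : ∀ {P : Fin n → Set} {u v} → WalkIn G P u v → P v
      walk-end s = walk-start (walk-sym s)

      other-vertex : ∀ c → ∃ λ v → v ∈ zs × v ≢ c
      other-vertex c with zs | distinct C | Cycle.long C
      ... | _ ∷ [] | _ | s≤s ()
      ... | a ∷ b ∷ _ | (a≢b ∷ _) ∷ _ | _ with a Fin.≟ c
      ...   | no a≢c = a , here ≡.refl , a≢c
      ...   | yes ≡.refl = b , there (here ≡.refl) , a≢b ∘ ≡.sym

      -- Two attachments that differ in both `h` and `c` are needed. `α₂` avoids `h α₁` and `α₃`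
      -- avoids `c α₁`; if neither forms such a pair with `α₁`, then `α₂` and `α₃` form one.
      off-edge-⊥ : ∀ {p q} → p ~ q → Off p → Off q → ⊥
      off-edge-⊥ {p} {q} pq p∉ q∉ = distinguish (c α₁ Fin.≟ c α₂) (h α₁ Fin.≟ h α₃)
        where
        on-off : ∀ {a b} → a ∈ zs → Off b → a ≢ b
        on-off a∈ b∉ a≡b = b∉ (subst (_∈ zs) a≡b a∈)
        via : ∀ {u v} → WalkIn G Off p u → WalkIn G Off p v → WalkIn G Off u v
        via s r = walk-++ (walk-sym s) r
        z = proj₁ (other-vertex p)
        z∈ = proj₁ (proj₂ (other-vertex p))
        α₁ : Attachment (λ _ → ⊤) p
        α₁ = attachment (connected p z tt tt) p∉ z∈
        avoid : ∀ x → Off x → Attachment (_≢ x) p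
        avoid x x∉ with p Fin.≟ x
        ... | no p≢x = attachment (connected-minus x p z p≢x (on-off z∈ x∉)) p∉ z∈
        -- A walk avoiding `p` cannot start there, so it starts at `q`, and the edge to `q` is put
        -- in front; only `h` and `c` have to differ from `x`.
        ... | yes ≡.refl
          with attachment (connected-minus p q z (edge⇒≢ pq ∘ ≡.sym) (on-off z∈ p∉)) q∉ z∈
        ...   | attach s e c∈ qh qc = attach (step p∉ pq s) e c∈ qh qc
        α₂ : Attachment (_≢ h α₁) p
        α₂ = avoid (h α₁) (walk-end (walk α₁))
        α₃ : Attachment (_≢ c α₁) p
        α₃ with other-vertex (c α₁)
        ... | v , v∈ , v≢c =
          attachment (connected-minus (c α₁) p v (on-off (c∈zs α₁) p∉ ∘ ≡.sym) v≢c) p∉ v∈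
        separate : ∀ {Q R} (β : Attachment Q p) (γ : Attachment R p) → h β ≢ h γ → c β ≢ c γ → ⊥
        separate β γ h≢ c≢ =
          attached-walk-⊥ (via (walk β) (walk γ)) h≢ (edge β) (edge γ) (c∈zs β) (c∈zs γ) c≢
        distinguish : Dec (c α₁ ≡ c α₂) → Dec (h α₁ ≡ h α₃) → ⊥
        distinguish (no c≢) _ = separate α₁ α₂ (Qh α₂ ∘ ≡.sym) c≢
        distinguish (yes _) (no h≢) = separate α₁ α₃ h≢ (Qc α₃ ∘ ≡.sym)
        distinguish (yes c₁≡c₂) (yes h₁≡h₃) = separate α₂ α₃
          (λ h₂≡h₃ → Qh α₂ (≡.trans h₂≡h₃ (≡.sym h₁≡h₃)))
          (λ c₂≡c₃ → Qc α₃ (≡.sym (≡.trans c₁≡c₂ c₂≡c₃)))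

      dominating : Dominating G C
      dominating u v uv with u ∈? zs | v ∈? zs
      ... | yes u∈ | _ = inj₁ u∈
      ... | no _ | yes v∈ = inj₂ v∈
      ... | no u∉ | no v∉ = ⊥-elim (off-edge-⊥ uv u∉ v∉)

theorem6 : ∀ {n} (G : Graph n) → TwoConnected G → Free K13ss G → Free K3 G →
    Σ (Cycle G) λ C → LongestCycle G C × Dominating G C
theorem6 G twoConnected noSpider noTriangle with longest G (some-cycle G twoConnected)
... | C , maximal = C , maximal , dominating G noSpider noTriangle twoConnected C maximal
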